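{- For every $k \in \mathbb{N}$ and every minimally unsatisfiable clause-set $F$ with $\delta(F) \le k$ and $F \neq \{\bot\}$ we have $\mathrm{minvdeg}(F) \le \mathrm{N}(k)$. More precisely, there exists a variable $v \in \mathrm{var}(F)$ with $\mathrm{vdeg}_F(v) \le \mathrm{N}(k)$ and $\mathrm{ld}_F(v) \le k$, $\mathrm{ld}_F(\overline{v}) \le k$.
   Context: Literals come with a fixed-point-free involution $x \mapsto \overline{x}$ (complementation); variables are the positive literals, and $\mathrm{var}(x)$ is the underlying variable of a literal $x$. A clause is a finite set $C$ of literals with $C \cap \overline{C} = \emptyset$, where $\overline{L} = \{\overline{x} : x \in L\}$; a clause-set is a finite set of clauses. $\bot$ is the empty clause. For a clause-set $F$: $\mathrm{var}(F)$ is the set of variables occurring in $F$, $n(F) = |\mathrm{var}(F)|$, $c(F) = |F|$, and the deficiency is $\delta(F) = c(F) - n(F)$. A partial assignment is a map $\varphi : V \to \{0,1\}$ for a finite set $V$ of variables, extended to literals by $\varphi(\overline{v}) = 1 - \varphi(v)$; $F$ is satisfiable iff there is a partial assignment $\varphi$ such that every clause of $F$ contains a literal $x$ with $\varphi(x) = 1$. $F$ is minimally unsatisfiable if $F$ is unsatisfiable and $F \setminus \{C\}$ is satisfiable for every $C \in F$. The literal degree $\mathrm{ld}_F(x)$ is the number of clauses of $F$ containing $x$; the variable degree is $\mathrm{vdeg}_F(v) = \mathrm{ld}_F(v) + \mathrm{ld}_F(\overline{v})$; $\mathrm{minvdeg}(F) = \min_{v \in \mathrm{var}(F)} \mathrm{vdeg}_F(v)$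 if $n(F) > 0$ and $+\infty$ otherwise. The function $\mathrm{N} : \mathbb{N} \to \mathbb{N}$ (non-Mersenne numbers) is defined recursively by $\mathrm{N}(1) = 2$ and, for $k \ge 2$, $\mathrm{N}(k) = \max_{i \in \{2,\dots,k\}} \min(2i, \mathrm{N}(k-i+1) + i)$. Here $\mathbb{N} = \{1,2,\dots\}$. -}

module Defs where

open import Data.Bool using (Bool; true; not)
open import Data.Integer using (ℤ; _⊖_)
open import Data.List using (List; []; _∷_; map; concatMap; filter; length; deduplicate; applyUpTo)
open import Data.List.Extrema.Nat using (max; min)
open import Data.List.Properties using (map-cong-local)
open import Data.List.Relation.Unary.All using ([])
import Data.List.Relation.Unary.All.Properties as All
open import Data.List.Relation.Unary.AllPairs using ([]; _∷_)
import Data.List.Relation.Binary.Disjoint.Propositional as Disjoint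
import Data.List.Relation.Binary.Subset.DecPropositional as Subset
import Data.List.Membership.DecPropositional as DecMembership
import Data.List.Membership.Setoid as SetoidMembership
import Data.List.Relation.Binary.Subset.Setoid as SetoidSubset
import Data.List.Relation.Unary.Unique.Setoid as SetoidUnique
import Data.List.Relation.Unary.Unique.Setoid.Properties as Unique
open import Data.Maybe using (Maybe; just)
import Data.Maybe as Maybe
open import Data.Nat using (ℕ; zero; suc; _+_; _*_; _∸_; _⊓_; _≤_; _<_; z≤n; s≤s)
open import Data.Nat.Properties using (≤-refl; ≤-trans; ≤-reflexive; +-comm; m∸n≤m)
open import Data.Product using (_×_; _,_; ∃-syntax; proj₁; proj₂; swap)
open import Function using (_∘_; id)
open import Relation.Binary using (Rel; Setoid; DecidableEquality; Decidable)
open import Relation.Binary.PropositionalEquality using (_≡_; refl; cong)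
open import Relation.Nullary using (¬_; no)
open import Relation.Nullary.Decidable using (map′; ¬?; _×-dec_)
open import Relation.Nullary.Construct.Add.Supremum using (_⁺; ⊤⁺; [_])
open import Relation.Binary.Construct.Add.Supremum.NonStrict _≤_ public using (_≤⁺_)

-- {2,…,k}
2⋯_ : ℕ → List ℕ
2⋯ k = applyUpTo (2 +_) (k ∸ 1)

-- The first argument bounds the recursion depth; k itself is deep enough, as
-- every recursive call is at k ∸ i + 1 < k (see N-rec).
N-bounded : ℕ → ℕ → ℕ
N-bounded zero    _ = 0
N-bounded (suc d) 0 = 0
N-bounded (suc d) 1 = 2
N-bounded (suc d) k =
  max 0 (map (λ i → (2 * i) ⊓ (N-bounded d (k ∸ i + 1) + i)) (2⋯ k))

-- The non-Mersenne numbers; N 0 is a junk value.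
N : ℕ → ℕ
N k = N-bounded k k

private
  step : ∀ m {i} → i < suc m → suc (suc m) ∸ (2 + i) + 1 ≤ suc m
  step m {i} _ = ≤-trans (≤-reflexive (+-comm (m ∸ i) 1)) (s≤s (m∸n≤m m i))

  N-bounded-irr : ∀ d e k → k ≤ d → k ≤ e → N-bounded d k ≡ N-bounded e k
  N-bounded-irr zero    zero    k k≤d k≤e = refl
  N-bounded-irr zero    (suc e) 0 k≤d k≤e = refl
  N-bounded-irr (suc d) zero    0 k≤d k≤e = refl
  N-bounded-irr (suc d) (suc e) 0 k≤d k≤e = refl
  N-bounded-irr (suc d) (suc e) 1 k≤d k≤e = refl
  N-bounded-irr (suc d) (suc e) (suc (suc m)) (s≤s m<d) (s≤s m<e) =
    cong (max 0) (map-cong-local (All.applyUpTo⁺₁ (2 +_) (suc m) λ {i} i<n →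
      cong (λ x → (2 * (2 + i)) ⊓ (x + (2 + i)))
        (N-bounded-irr d e _ (≤-trans (step m i<n) m<d) (≤-trans (step m i<n) m<e))))

N-one : N 1 ≡ 2
N-one = refl

N-rec : ∀ k → 2 ≤ k →
        N k ≡ max 0 (map (λ i → (2 * i) ⊓ (N (k ∸ i + 1) + i)) (2⋯ k))
N-rec (suc zero) (s≤s ())
N-rec (suc (suc m)) _ =
  cong (max 0) (map-cong-local (All.applyUpTo⁺₁ (2 +_) (suc m) λ {i} i<n →
    cong (λ x → (2 * (2 + i)) ⊓ (x + (2 + i)))
      (N-bounded-irr (suc m) _ _ (step m i<n) ≤-refl)))

module CNF {V : Set} (_≟_ : DecidableEquality V) where

  data Literal : Set where
    pos neg : V → Literal

  var : Literal → V
  var (pos v) = v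
  var (neg v) = v

  infix 9 ‾_
  ‾_ : Literal → Literal
  ‾ pos v = neg v
  ‾ neg v = pos v

  _≟ˡ_ : DecidableEquality Literal
  pos v ≟ˡ pos w = map′ (cong pos) (λ { refl → refl }) (v ≟ w)
  pos v ≟ˡ neg w = no λ ()
  neg v ≟ˡ pos w = no λ ()
  neg v ≟ˡ neg w = map′ (cong neg) (λ { refl → refl }) (v ≟ w)

  open DecMembership _≟ˡ_ public using () renaming (_∈_ to _∈ˡ_; _∈?_ to _∈ˡ?_)
  open DecMembership _≟_ public using () renaming (_∈_ to _∈ᵛ_; _∈?_ to _∈ᵛ?_)
  open Subset _≟ˡ_ using (_⊆_; _⊆?_)
  open Disjoint {A = Literal} using (Disjoint)

  -- The list stands for its set of elements: order and repetition are
  -- irrelevant, and clauses are compared by _≈_ only.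
  record Clause : Set where
    field
      literals   : List Literal
      clash-free : Disjoint literals (map ‾_ literals)

  open Clause public

  infix 4 _≈_ _≈?_
  _≈_ : Rel Clause _
  C ≈ D = literals C ⊆ literals D × literals D ⊆ literals C

  _≈?_ : Decidable _≈_
  C ≈? D = (literals C ⊆? literals D) ×-dec (literals D ⊆? literals C)

  clauseSetoid : Setoid _ _
  clauseSetoid = record
    { Carrier       = Clause
    ; _≈_           = _≈_
    ; isEquivalence = record
      { refl  = id , id
      ; sym   = swap
      ; trans = λ p q → proj₁ q ∘ proj₁ p , proj₂ p ∘ proj₂ q
      }
    }

  open SetoidMembership clauseSetoid public using () renaming (_∈_ to _∈ᶜ_)
  open SetoidSubset clauseSetoid public using () renaming (_⊆_ to _⊆ᶜ_)
  open SetoidUnique clauseSetoid using (Unique)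

  -- A finite set of clauses, listed without repetition up to _≈_, so that
  -- lengths of (sub)lists are cardinalities.
  record ClauseSet : Set where
    field
      clauses  : List Clause
      distinct : Unique clauses

  open ClauseSet public

  infix 4 _≋_
  _≋_ : Rel ClauseSet _
  F ≋ G = clauses F ⊆ᶜ clauses G × clauses G ⊆ᶜ clauses F

  ⊥ᶜ : Clause
  ⊥ᶜ = record { literals = [] ; clash-free = λ () }

  ⟨_⟩ : Clause → ClauseSet
  ⟨ C ⟩ = record { clauses = C ∷ [] ; distinct = [] ∷ [] }

  infixl 6 _∖_
  _∖_ : ClauseSet → Clause → ClauseSet
  F ∖ C = record
    { clauses  = filter (λ D → ¬? (D ≈? C)) (clauses F)
    ; distinct = Unique.filter⁺ clauseSetoid (λ D → ¬? (D ≈? C)) (distinct F)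
    }

  vars : ClauseSet → List V
  vars F = deduplicate _≟_ (concatMap (map var ∘ literals) (clauses F))

  n : ClauseSet → ℕ
  n F = length (vars F)

  c : ClauseSet → ℕ
  c F = length (clauses F)

  δ : ClauseSet → ℤ
  δ F = c F ⊖ n F

  -- A partial function V ⇀ {0,1}, undefined outside a finite set.
  record PartialAssignment : Set where
    field
      value   : V → Maybe Bool
      support : List V
      finite  : ∀ {v b} → value v ≡ just b → v ∈ᵛ support

  open PartialAssignment public

  evaluate : PartialAssignment → Literal → Maybe Bool
  evaluate φ (pos v) = value φ v
  evaluate φ (neg v) = Maybe.map not (value φ v)

  Satisfiable : ClauseSet → Set
  Satisfiable F = ∃[ φ ] ∀ C → C ∈ᶜ clauses F →
    ∃[ x ] (x ∈ˡ literals C × evaluate φ x ≡ just true)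

  MinimallyUnsatisfiable : ClauseSet → Set
  MinimallyUnsatisfiable F =
    ¬ Satisfiable F × (∀ C → C ∈ᶜ clauses F → Satisfiable (F ∖ C))

  ld : ClauseSet → Literal → ℕ
  ld F x = length (filter (λ C → x ∈ˡ? literals C) (clauses F))

  vdeg : ClauseSet → V → ℕ
  vdeg F v = ld F (pos v) + ld F (‾ pos v)

  minvdeg : ClauseSet → ℕ ⁺
  minvdeg F with vars F
  ... | []     = ⊤⁺
  ... | v ∷ vs = [ min (vdeg F v) (map (vdeg F) vs) ]

{-# OPTIONS --safe #-}
-- Saturate F: adjoin literals to clauses while F stays unsatisfiable.  This
-- keeps minimality and the deficiency and only raises degrees.  In a saturated F
-- both results of splitting on a variable v are again minimally unsatisfiable,
-- and if v has minimal degree then no variable besides v is lost.  Hence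
-- v ↦ b, which removes i clauses, lowers the deficiency by i ∸ 1.  By induction
-- on the number of variables the deficiency is positive, which bounds the degree
-- of each literal of v by the deficiency k.  With i the larger of these
-- degrees, v has degree at most 2 i, and at most N (k ∸ i + 1) + i, since the
-- smaller clause-set has a variable of degree at most N (k ∸ i + 1), which
-- occurs in at most i of the removed clauses.
module Submission where

open import Defs
open import Data.Nat using (ℕ; NonZero; _≤_)
open import Data.Integer using (+_) renaming (_≤_ to _≤ᶻ_)
open import Data.Product using (_×_; ∃-syntax)
open import Relation.Binary using (DecidableEquality)
open import Relation.Nullary using (¬_)
open import Relation.Nullary.Construct.Add.Supremum using ([_])

open import Data.Bool using (Bool; true; false; not; if_then_else_)
import Data.Bool as Bool
open import Data.Bool.Properties using (not-¬; ¬-not)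
open import Data.Fin using (Fin)
import Data.Fin as Fin
open import Data.Integer using (_⊖_)
import Data.Integer.Properties as ℤ
open import Data.List using (List; []; _∷_; map; filter; length; lookup; allFin;
                             cartesianProduct)
open import Data.List.Extrema.Nat
  using (argmin; argmin-all; f[argmin]≤f[xs]; f[argmin]≤f[⊤]; xs≤max; min≤v⁺)
open import Data.List.Membership.Propositional using (_∈_; lose; find)
open import Data.List.Membership.Propositional.Properties
  using (∈-filter⁺; ∈-filter⁻; ∈-cartesianProduct⁺; ∈-length; ∈-map⁺; ∈-map⁻; ∈-applyUpTo⁺; ∈-allFin;
         ∈-deduplicate⁺; ∈-deduplicate⁻; ∈-concatMap⁺; ∈-concatMap⁻; ∈-lookup)
open import Data.List.Membership.Setoid.Properties using () renaming (∈-resp-≈ to Setoid-∈-resp-≈)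
open import Data.List.Properties
  using (filter-accept; filter-reject; filter-all; filter-some; length-tabulate;
         map-tabulate; tabulate-lookup)
open import Data.List.Relation.Unary.All using (All; []; _∷_)
import Data.List.Relation.Unary.All as All
open import Data.List.Relation.Unary.All.Properties using (¬All⇒Any¬)
open import Data.List.Relation.Unary.AllPairs using ([]; _∷_)
open import Data.List.Relation.Unary.Any using (Any; here; there)
import Data.List.Relation.Unary.Any as Any
open import Data.List.Relation.Unary.Any.Properties using (lookup-index)
open import Data.List.Relation.Unary.Unique.DecPropositional.Properties using (deduplicate-!)
open import Data.List.Relation.Unary.Unique.Propositional using (Unique)
open import Data.List.Relation.Unary.Unique.Propositional.Properties using (filter⁺; allFin⁺)
open import Data.List.Relation.Unary.Unique.Setoid using () renaming (Unique to Setoid-Unique)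
open import Data.Maybe using (Maybe; just; nothing; fromMaybe)
open import Data.Maybe.Properties using (just-injective) renaming (≡-dec to ≡-decᴹ)
open import Data.Nat using (zero; suc; _+_; _*_; _∸_; _⊓_; _<_; z≤n; s≤s; s≤s⁻¹)
open import Data.Nat.Properties hiding (_≟_)
open import Data.Nat.Tactic.RingSolver using (solve-∀)
open import Data.Product using (_,_; proj₁; proj₂; ∃; swap)
open import Data.Sum using (_⊎_; inj₁; inj₂)
open import Level using (0ℓ)
open import Function using (_∘_; id; case_of_)
open import Relation.Binary using (Setoid)
open import Relation.Binary.Construct.Add.Supremum.NonStrict _≤_ using () renaming ([_] to [_]⁺)
open import Relation.Binary.PropositionalEquality
  using (_≡_; _≢_; refl; sym; trans; cong; cong₂; subst)
open import Relation.Nullary using (Dec; yes; no; does; contradiction)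
open import Relation.Nullary.Decidable using (map′; ¬?; _×-dec_; _⊎-dec_; decidable-stable; dec-true; dec-false)
open import Relation.Unary using (Pred; Decidable)

-- Counting in filtered lists, and updating functions at a point.

length-filter-∁ : ∀ {A : Set} {P : Pred A 0ℓ} (P? : Decidable P) xs →
                  length xs ≡ length (filter P? xs) + length (filter (¬? ∘ P?) xs)
length-filter-∁ P? [] = refl
length-filter-∁ P? (x ∷ xs) with P? x
... | yes _ = cong suc (length-filter-∁ P? xs)
... | no  _ = trans (cong suc (length-filter-∁ P? xs)) (sym (+-suc _ _))

module _ {A : Set} {P Q : Pred A 0ℓ} (P? : Decidable P) (Q? : Decidable Q) where

  length-filter-mono-≤ : ∀ xs → (∀ {x} → x ∈ xs → P x → Q x) →
                         length (filter P? xs) ≤ length (filter Q? xs)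
  length-filter-mono-≤ [] P⇒Q = z≤n
  length-filter-mono-≤ (x ∷ xs) P⇒Q with length-filter-mono-≤ xs (P⇒Q ∘ there) | P? x | Q? x
  ... | ih | yes p | yes q = s≤s ih
  ... | ih | yes p | no ¬q = contradiction (P⇒Q (here refl) p) ¬q
  ... | ih | no _  | yes q = m≤n⇒m≤1+n ih
  ... | ih | no _  | no _  = ih

  length-filter-mono-< : ∀ xs → (∀ {x} → x ∈ xs → P x → Q x) →
                         ∀ {x} → x ∈ xs → ¬ P x → Q x →
                         length (filter P? xs) < length (filter Q? xs)
  length-filter-mono-< (x ∷ xs) P⇒Q (here refl) ¬p q with P? x | Q? x
  ... | yes p | _     = contradiction p ¬p
  ... | no _  | yes _ = s≤s (length-filter-mono-≤ xs (P⇒Q ∘ there))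
  ... | no _  | no ¬q = contradiction q ¬q
  length-filter-mono-< (x ∷ xs) P⇒Q (there y∈) ¬p q
    with length-filter-mono-< xs (P⇒Q ∘ there) y∈ ¬p q | P? x | Q? x
  ... | ih | yes p | yes q = s≤s ih
  ... | ih | yes p | no ¬q = contradiction (P⇒Q (here refl) p) ¬q
  ... | ih | no _  | yes q = m≤n⇒m≤1+n ih
  ... | ih | no _  | no _  = ih

module _ {A : Set} (_≟_ : DecidableEquality A) where

  length-remove : ∀ {x : A} {xs} → Unique xs → x ∈ xs →
                  suc (length (filter (λ y → ¬? (y ≟ x)) xs)) ≡ length xs
  length-remove {x} {_ ∷ xs} (x∉ ∷ _) (here refl) = cong suc (trans
    (cong length (filter-reject (λ y → ¬? (y ≟ x)) {x} {xs} λ ¬refl → ¬refl refl))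
    (cong length (filter-all (λ y → ¬? (y ≟ x)) (All.map (λ x≢y → x≢y ∘ sym) x∉))))
  length-remove {x} {y ∷ xs} (y∉ ∷ u) (there x∈) = cong suc (trans
    (cong length (filter-accept (λ z → ¬? (z ≟ x)) {y} {xs} (All.lookup y∉ x∈)))
    (length-remove u x∈))

  _[_≔_] : {B : Set} → (A → B) → A → B → A → B
  (f [ x ≔ b ]) y = if does (y ≟ x) then b else f y

  ≔-same : ∀ {B : Set} (f : A → B) x b → (f [ x ≔ b ]) x ≡ b
  ≔-same f x b rewrite dec-true (x ≟ x) refl = refl

  ≔-other : ∀ {B : Set} (f : A → B) {x b y} → y ≢ x → (f [ x ≔ b ]) y ≡ f y
  ≔-other f {x} {b} {y} y≢x rewrite dec-false (y ≟ x) y≢x = refl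

-- Lower bounds for non-Mersenne numbers.

N-lower : ∀ k i → 2 ≤ i → i ≤ k → (2 * i) ⊓ (N (k ∸ i + 1) + i) ≤ N k
N-lower _ (suc zero) (s≤s ()) _
N-lower k i@(suc (suc j)) 2≤i i≤k =
  subst ((2 * i) ⊓ (N (k ∸ i + 1) + i) ≤_) (sym (N-rec k (≤-trans 2≤i i≤k)))
    -- `2⋯ k` lists `2 + j` for `j < k ∸ 1`, so the index of `i` is `i ∸ 2`.
    (All.lookup (xs≤max 0 _) (∈-map⁺ _ (∈-applyUpTo⁺ (_+_ 2) (∸-monoˡ-≤ 1 i≤k))))

-- For `k ≥ 2` the term of the maximum at `i = 2` suffices, both of its arguments being at least 2.
-- This serves variables that occur at most once with each sign, which the recursion, starting at
-- `i = 2`, does not reach.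
2≤N : ∀ k → 1 ≤ k → 2 ≤ N k
2≤N 1 _ = ≤-refl
2≤N k@(suc (suc _)) _ =
  ≤-trans (⊓-glb (s≤s (s≤s z≤n)) (m≤n+m 2 _)) (N-lower k 2 ≤-refl (s≤s (s≤s z≤n)))

-- Row i of a matrix is a clause: entry just b at v stands for the literal of v
-- that is made true by v ↦ b, and nothing for v not occurring.  Only the
-- submatrix with rows R and columns X matters, so that splitting on a variable
-- merely shrinks R and X.
module Matrices {I V : Set} (_≟ᴵ_ : DecidableEquality I) (_≟_ : DecidableEquality V) where

  -- Assignments and decidable satisfiability.

  _≟ᴹ_ : DecidableEquality (Maybe Bool)
  _≟ᴹ_ = ≡-decᴹ Bool._≟_

  Assignment : Set
  Assignment = V → Bool

  Matrix : Set
  Matrix = I → V → Maybe Bool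

  -- Since `P` depends only on the values on `X`, trying both values at each element of `X` is
  -- exhaustive, even if `V` is infinite. With `X` empty, one arbitrary assignment represents all.
  anyAssignment? : ∀ X {P : Assignment → Set} → Decidable P →
                   (∀ {a b} → (∀ {v} → v ∈ X → a v ≡ b v) → P a → P b) → Dec (∃ P)
  anyAssignment? [] P? resp = map′ (_ ,_) (λ (_ , p) → resp (λ ()) p) (P? λ _ → false)
  anyAssignment? (x ∷ X) {P} P? resp =
    map′ (λ { (a , inj₁ p) → _ , p ; (a , inj₂ p) → _ , p })
         (λ (a , p) → a , choose a (a x) refl p)
         (anyAssignment? X {λ a → P (set a true) ⊎ P (set a false)}
           (λ a → P? (set a true) ⊎-dec P? (set a false))
           λ a≗b → λ { (inj₁ p) → inj₁ (resp (agree a≗b) p)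
                     ; (inj₂ p) → inj₂ (resp (agree a≗b) p) })
    where
    set : Assignment → Bool → Assignment
    set a b = _[_≔_] _≟_ a x b

    agree : ∀ {a a′ b} → (∀ {v} → v ∈ X → a v ≡ a′ v) → ∀ {v} → v ∈ x ∷ X → set a b v ≡ set a′ b v
    agree {a} {a′} {b} eq {v} v∈ with v ≟ x | v∈
    ... | yes _   | _         = refl
    ... | no v≢x | here v≡x  = contradiction v≡x v≢x
    ... | no _   | there v∈X = eq v∈X

    set-self : ∀ a {b} → a x ≡ b → ∀ v → a v ≡ set a b v
    set-self a eq v with v ≟ x
    ... | yes refl = eq
    ... | no _     = refl

    choose : ∀ a b → a x ≡ b → P a → P (set a true) ⊎ P (set a false)
    choose a true  eq p = inj₁ (resp (λ _ → set-self a eq _) p)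
    choose a false eq p = inj₂ (resp (λ _ → set-self a eq _) p)

  Satisfies : Matrix → List V → Assignment → I → Set
  Satisfies M X a i = Any (λ v → M i v ≡ just (a v)) X

  satisfies? : ∀ M X a → Decidable (Satisfies M X a)
  satisfies? M X a i = Any.any? (λ v → M i v ≟ᴹ just (a v)) X

  Satisfies-resp : ∀ {M X a b i} → (∀ {v} → v ∈ X → a v ≡ b v) → Satisfies M X a i → Satisfies M X b i
  Satisfies-resp a≗b s with v , v∈X , eq ← find s = lose v∈X (trans eq (cong just (a≗b v∈X)))

  Sat : Matrix → List I → List V → Set
  Sat M R X = ∃[ a ] All (Satisfies M X a) R

  sat? : ∀ M R X → Dec (Sat M R X)
  sat? M R X = anyAssignment? X (λ a → All.all? (satisfies? M X a) R)
                 (λ a≗b → All.map (Satisfies-resp {M} a≗b))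

  -- Degrees and minimal unsatisfiability of matrices.

  degree : Matrix → List I → Bool → V → ℕ
  degree M R b v = length (filter (λ i → M i v ≟ᴹ just b) R)

  occurrences : Matrix → List I → V → ℕ
  occurrences M R v = length (filter (λ i → ¬? (M i v ≟ᴹ nothing)) R)

  occurrences≡ : ∀ M R v → occurrences M R v ≡ degree M R true v + degree M R false v
  occurrences≡ M [] v = refl
  occurrences≡ M (i ∷ R) v with M i v
  ... | just true  = cong suc (occurrences≡ M R v)
  ... | just false = trans (cong suc (occurrences≡ M R v)) (sym (+-suc _ _))
  ... | nothing    = occurrences≡ M R v

  -- By `occurs`, no column of `X` is empty on `R`, so that `length X` counts variables that really
  -- occur and the deficiency is `length R` minus `length X`.
  record MinUnsat (M : Matrix) (R : List I) (X : List V) : Set where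
    field
      unsat    : ¬ Sat M R X
      critical : ∀ {i} → i ∈ R → ∃[ a ] (∀ {j} → j ∈ R → j ≢ i → Satisfies M X a j)
      occurs   : ∀ {v} → v ∈ X → ∃[ i ] (i ∈ R × M i v ≢ nothing)

    falsified : ∀ a → ∃[ i ] (i ∈ R × ¬ Satisfies M X a i)
    falsified a = find (¬All⇒Any¬ (satisfies? M X a) R (λ s → unsat (a , s)))

    critical-falsified : ∀ {i} (i∈R : i ∈ R) → ¬ Satisfies M X (proj₁ (critical i∈R)) i
    critical-falsified {i} i∈R s with a , crit ← critical i∈R with j , j∈R , ¬s ← falsified a with j ≟ᴵ i
    ... | yes refl = ¬s s
    ... | no j≢i  = ¬s (crit j∈R j≢i)

  open MinUnsat

  -- The clause i can be falsified alone by an assignment with v ↦ b, unless it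
  -- contains the literal made true by b.
  Saturated : Matrix → List I → List V → Set
  Saturated M R X = ∀ {i v} b → i ∈ R → v ∈ X → M i v ≢ just b →
    ∃[ a ] (a v ≡ b × (∀ {j} → j ∈ R → j ≢ i → Satisfies M X a j))

  -- Saturation.

  extend : Matrix → I → V → Bool → Matrix
  extend M i v b = _[_≔_] _≟ᴵ_ M i (_[_≔_] _≟_ (M i) v (just b))

  _⊑_ : Matrix → Matrix → Set
  M ⊑ M′ = ∀ i v {b} → M i v ≡ just b → M′ i v ≡ just b

  module _ (M : Matrix) (i : I) (v : V) (b : Bool) where

    private
      new-row : V → Maybe Bool
      new-row = _[_≔_] _≟_ (M i) v (just b)

    extend-same : extend M i v b i v ≡ just b
    extend-same rewrite ≔-same _≟ᴵ_ M i new-row = ≔-same _≟_ (M i) v (just b)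

    extend-row : ∀ {j w} → j ≢ i → extend M i v b j w ≡ M j w
    extend-row {w = w} j≢i = cong (λ f → f w) (≔-other _≟ᴵ_ M j≢i)

    extend-other : ∀ {w} → w ≢ v → extend M i v b i w ≡ M i w
    extend-other w≢v rewrite ≔-same _≟ᴵ_ M i new-row = ≔-other _≟_ (M i) w≢v

    ⊑-extend : M i v ≡ nothing → M ⊑ extend M i v b
    ⊑-extend hole j w eq = case j ≟ᴵ i of λ
      { (no j≢i) → trans (extend-row j≢i) eq
      ; (yes refl) → case w ≟ v of λ
        { (no w≢v) → trans (extend-other w≢v) eq
        ; (yes refl) → contradiction (trans (sym hole) eq) λ () } }

  Satisfies-⊑ : ∀ {M M′ X a i} → M ⊑ M′ → Satisfies M X a i → Satisfies M′ X a i
  Satisfies-⊑ M⊑M′ = Any.map (M⊑M′ _ _)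

  occurs-⊑ : ∀ {M M′} → M ⊑ M′ → ∀ i v → M i v ≢ nothing → M′ i v ≢ nothing
  occurs-⊑ {M} M⊑M′ i v M≢ M′≡ with M i v in eq
  ... | nothing = M≢ refl
  ... | just b with () ← trans (sym M′≡) (M⊑M′ i v eq)

  -- Clauses only grow, so critical assignments stay critical and variables keep occurring;
  -- unsatisfiability alone can fail and is therefore a hypothesis.
  MinUnsat-⊑ : ∀ {M M′ R X} → M ⊑ M′ → ¬ Sat M′ R X → MinUnsat M R X → MinUnsat M′ R X
  MinUnsat-⊑ {M} M⊑M′ unsat′ mu = record
    { unsat    = unsat′
    ; critical = λ i∈R → let a , crit = critical mu i∈R in
        a , λ j∈R j≢i → Satisfies-⊑ {M} M⊑M′ (crit j∈R j≢i)
    ; occurs   = λ v∈X → let i , i∈R , occ = occurs mu v∈X in i , i∈R , occurs-⊑ {M} M⊑M′ i _ occ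
    }

  hole? : (M : Matrix) → Decidable (λ ((i , v) : I × V) → M i v ≡ nothing)
  hole? M (i , v) = M i v ≟ᴹ nothing

  holes : Matrix → List I → List V → ℕ
  holes M R X = length (filter (hole? M) (cartesianProduct R X))

  Extendable : Matrix → List I → List V → I → V → Bool → Set
  Extendable M R X i v b = M i v ≡ nothing × ¬ Sat (extend M i v b) R X

  extendable? : ∀ M R X →
                Dec (Any (λ i → Any (λ v → Any (Extendable M R X i v) (true ∷ false ∷ [])) X) R)
  extendable? M R X = Any.any? (λ i → Any.any? (λ v → Any.any? (λ b →
    (M i v ≟ᴹ nothing) ×-dec ¬? (sat? (extend M i v b) R X)) _) X) R

  -- If `v` occurs in clause `i` with the sign opposite to `b`, every critical assignment for `i`
  -- falsifies that literal and so has `v ↦ b`. If `v` does not occur in clause `i`, adjoining the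
  -- literal makes the clauses satisfiable; a solution satisfies all other clauses, hence not the
  -- old clause `i`, so it must make the new literal true.
  ¬extendable⇒saturated : ∀ {M R X} → MinUnsat M R X →
    (∀ {i v b} → i ∈ R → v ∈ X → ¬ Extendable M R X i v b) → Saturated M R X
  ¬extendable⇒saturated {M} {R} {X} mu ¬ext {i} {v} b i∈R v∈X ≢b with M i v in eq
  ... | just b′ = a , trans (¬-not λ eq′ → critical-falsified mu i∈R
                              (lose v∈X (trans eq (cong just (sym eq′)))))
                            (sym (¬-not (λ b≡b′ → ≢b (cong just (sym b≡b′)))))
                    , crit
    where
    a = proj₁ (critical mu i∈R)
    crit = λ {j} → proj₂ (critical mu i∈R) {j}
  ... | nothing with sat? (extend M i v b) R X
  ...   | no ¬sat = contradiction (eq , ¬sat) (¬ext i∈R v∈X)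
  ...   | yes (a , sat) with k , k∈R , ¬s ← falsified mu a = a , sym value , others
    where
    others : ∀ {j} → j ∈ R → j ≢ i → Satisfies M X a j
    others j∈R j≢i = Any.map (trans (sym (extend-row M i v b j≢i))) (All.lookup sat j∈R)

    ¬s-i : ¬ Satisfies M X a i
    ¬s-i s with k ≟ᴵ i
    ... | yes refl = ¬s s
    ... | no k≢i  = ¬s (others k∈R k≢i)

    value : b ≡ a v
    value with w , w∈X , e ← find (All.lookup sat i∈R) with w ≟ v
    ... | yes refl = just-injective (trans (sym (extend-same M i v b)) e)
    ... | no w≢v  = contradiction (lose w∈X (trans (sym (extend-other M i v b w≢v)) e)) ¬s-i

  -- Greedy extension terminates because each adjoined literal fills a hole; `h` bounds the number
  -- of holes left.
  saturate : ∀ h {M R X} → holes M R X ≤ h → MinUnsat M R X →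
             ∃[ M′ ] (M ⊑ M′ × MinUnsat M′ R X × Saturated M′ R X)
  saturate h {M} {R} {X} holes≤h mu with extendable? M R X
  ... | no ¬ext = M , (λ _ _ → id) , mu , ¬extendable⇒saturated mu
        (λ i∈R v∈X ext → ¬ext (lose i∈R (lose v∈X (lose (bool∈ _) ext))))
    where
    bool∈ : ∀ b → b ∈ true ∷ false ∷ []
    bool∈ true  = here refl
    bool∈ false = there (here refl)
  ... | yes ext with i , i∈R , ext′ ← find ext with v , v∈X , ext″ ← find ext′
                with b , _ , hole , ¬sat ← find ext″ = go h holes≤h
    where
    M⁺ = extend M i v b

    M⊑M⁺ : M ⊑ M⁺
    M⊑M⁺ = ⊑-extend M i v b hole

    fewer : holes M⁺ R X < holes M R X
    fewer = length-filter-mono-< (hole? M⁺) (hole? M) (cartesianProduct R X)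
      (λ {(j , w)} _ eq → decidable-stable (M j w ≟ᴹ nothing) λ M≢ → occurs-⊑ M⊑M⁺ j w M≢ eq)
      (∈-cartesianProduct⁺ i∈R v∈X)
      (λ eq → contradiction (trans (sym eq) (extend-same M i v b)) λ ()) hole

    go : ∀ h → holes M R X ≤ h → ∃[ M′ ] (M ⊑ M′ × MinUnsat M′ R X × Saturated M′ R X)
    go zero    ≤0 = contradiction (≤-trans fewer ≤0) λ ()
    go (suc h) ≤h with M′ , M⁺⊑M′ , rest
      ← saturate h (s≤s⁻¹ (≤-trans fewer ≤h)) (MinUnsat-⊑ M⊑M⁺ ¬sat mu)
      = M′ , (λ i v → M⁺⊑M′ i v ∘ M⊑M⁺ i v) , rest

  -- Splitting on a variable.

  keep : Matrix → List I → V → Bool → List I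
  keep M R v b = filter (λ i → ¬? (M i v ≟ᴹ just b)) R

  drop : List V → V → List V
  drop X v = filter (λ w → ¬? (w ≟ v)) X

  -- Let `v` occur in clause `i` with sign `b′` other than `b`. A critical assignment for `i`
  -- falsifies clause `i`; changing `v` to `b′` satisfies it, so another clause `j` becomes false.
  -- Before the change `j` was true, necessarily through `v` with sign `b`.
  both-polarities : ∀ {M R X v} → MinUnsat M R X → v ∈ X → ∀ b → ∃[ i ] (i ∈ R × M i v ≡ just b)
  both-polarities {M} {R} {X} {v} mu v∈X b with i , i∈R , occ ← occurs mu v∈X with M i v in eq
  ... | nothing = contradiction refl occ
  ... | just b′ with b′ Bool.≟ b
  ...   | yes refl = i , i∈R , eq
  ...   | no b′≢b with a , crit ← critical mu i∈R | ¬s ← critical-falsified mu i∈R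
        with j , j∈R , ¬s⁺ ← falsified mu (_[_≔_] _≟_ a v b′) with j ≟ᴵ i
  ...     | yes refl = contradiction (lose v∈X (trans eq (cong just (sym (≔-same _≟_ a v b′))))) ¬s⁺
  ...     | no j≢i with w , w∈X , e ← find (crit j∈R j≢i) with w ≟ v
  ...       | no w≢v = contradiction (lose w∈X (trans e (cong just (sym (≔-other _≟_ a w≢v))))) ¬s⁺
  ...       | yes refl = j , j∈R , trans e (cong just
              (trans (¬-not λ av≡b′ → ¬s (lose v∈X (trans eq (cong just (sym av≡b′)))))
                     (sym (¬-not (λ b≡b′ → b′≢b (sym b≡b′))))))

  module _ {M R X v} (mu : MinUnsat M R X) (saturated : Saturated M R X) (v∈X : v ∈ X)
           (minimal : ∀ {w} → w ∈ X → occurrences M R v ≤ occurrences M R w) where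

    -- A variable w lost in the splitting would occur only in the removed clauses,
    -- hence less often than v, which also occurs with the opposite sign.
    split : ∀ b → MinUnsat M (keep M R v b) (drop X v)
    split b = record { unsat = unsat′ ; critical = critical′ ; occurs = occurs′ }
      where
      keep? = λ i → ¬? (M i v ≟ᴹ just b)
      drop? = λ w → ¬? (w ≟ v)

      -- A solution of the kept clauses, updated by `v ↦ b`, would also satisfy the removed ones.
      unsat′ : ¬ Sat M (keep M R v b) (drop X v)
      unsat′ (a , sat) with i , i∈R , ¬s ← falsified mu (_[_≔_] _≟_ a v b) with M i v ≟ᴹ just b
      ... | yes eq = ¬s (lose v∈X (trans eq (cong just (sym (≔-same _≟_ a v b)))))
      ... | no ≢b with w , w∈ , e ← find (All.lookup sat (∈-filter⁺ keep? i∈R ≢b))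
                  with w∈X , w≢v ← ∈-filter⁻ drop? {xs = X} w∈ =
        ¬s (lose w∈X (trans e (cong just (sym (≔-other _≟_ a w≢v)))))

      -- Saturation supplies a critical assignment with `v ↦ b`. Kept clauses lack the literal made
      -- true by `b`, so those it satisfies are satisfied through variables other than `v`.
      critical′ : ∀ {i} → i ∈ keep M R v b →
                  ∃[ a ] (∀ {j} → j ∈ keep M R v b → j ≢ i → Satisfies M (drop X v) a j)
      critical′ i∈ with i∈R , ≢b ← ∈-filter⁻ keep? {xs = R} i∈
                   with a , av≡b , sat ← saturated b i∈R v∈X ≢b = a , sat′
        where
        sat′ : ∀ {j} → j ∈ keep M R v b → j ≢ _ → Satisfies M (drop X v) a j
        sat′ j∈ j≢i with j∈R , j≢b ← ∈-filter⁻ keep? {xs = R} j∈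
                    with w , w∈X , e ← find (sat j∈R j≢i) =
          lose (∈-filter⁺ drop? w∈X λ { refl → j≢b (trans e (cong just av≡b)) }) e

      occurs′ : ∀ {w} → w ∈ drop X v → ∃[ i ] (i ∈ keep M R v b × M i w ≢ nothing)
      occurs′ {w} w∈ with w∈X , w≢v ← ∈-filter⁻ drop? {xs = X} w∈
        with Any.any? (λ i → ¬? (M i w ≟ᴹ nothing)) (keep M R v b)
      ... | yes any = find any
      ... | no ¬any with i , i∈R , i≡ ← both-polarities mu v∈X (not b) =
        contradiction (minimal w∈X) (<⇒≱ (≤-<-trans
          (length-filter-mono-≤ (λ i → ¬? (M i w ≟ᴹ nothing)) (λ i → M i v ≟ᴹ just b) R
            λ {i} i∈R occ → decidable-stable (M i v ≟ᴹ just b) λ ≢b → ¬any (lose (∈-filter⁺ keep? i∈R ≢b) occ))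
          (length-filter-mono-< (λ i → M i v ≟ᴹ just b) (λ i → ¬? (M i v ≟ᴹ nothing)) R
            (λ _ eq eq′ → contradiction (trans (sym eq) eq′) λ ()) i∈R
            (λ eq → not-¬ refl (just-injective (trans (sym eq) i≡)))
            (λ eq → contradiction (trans (sym eq) i≡) λ ()))))

  -- Comparison of degrees, and matrices without columns.

  occurrences-keep : ∀ M R v b w →
                     occurrences M R w ≤ occurrences M (keep M R v b) w + degree M R b v
  occurrences-keep M [] v b w = z≤n
  occurrences-keep M (i ∷ R) v b w with occurrences-keep M R v b w | M i v ≟ᴹ just b
  ... | ih | yes _ with M i w ≟ᴹ nothing
  ...   | yes _ = ≤-trans ih (+-monoʳ-≤ (occurrences M (keep M R v b) w) (n≤1+n _))
  ...   | no _  = ≤-trans (s≤s ih) (≤-reflexive (sym (+-suc _ _)))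
  occurrences-keep M (i ∷ R) v b w | ih | no _ with M i w ≟ᴹ nothing
  ...   | yes _ = ih
  ...   | no _  = s≤s ih

  degree-mono : ∀ {M M′} R → M ⊑ M′ → ∀ b v → degree M R b v ≤ degree M′ R b v
  degree-mono {M} {M′} R M⊑M′ b v =
    length-filter-mono-≤ (λ i → M i v ≟ᴹ just b) (λ i → M′ i v ≟ᴹ just b) R (λ _ → M⊑M′ _ v)

  occurrences-mono : ∀ {M M′} R → M ⊑ M′ → ∀ v → occurrences M R v ≤ occurrences M′ R v
  occurrences-mono {M} {M′} R M⊑M′ v =
    length-filter-mono-≤ (λ i → ¬? (M i v ≟ᴹ nothing)) (λ i → ¬? (M′ i v ≟ᴹ nothing)) R
      (λ _ → occurs-⊑ M⊑M′ _ v)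

  -- Without columns no row can be satisfied, but with two distinct rows a critical assignment for
  -- the first would satisfy the second.
  length-rows≤1 : ∀ {M R X} → length X ≡ 0 → Unique R → MinUnsat M R X → length R ≤ 1
  length-rows≤1 {R = []} {[]} _ _ _ = z≤n
  length-rows≤1 {R = _ ∷ []} {[]} _ _ _ = ≤-refl
  length-rows≤1 {R = i ∷ j ∷ R} {[]} _ ((i≢j ∷ _) ∷ _) mu
    with () ← proj₂ (critical mu (here refl)) (there (here refl)) (i≢j ∘ sym)

  -- The degree bounds, by induction on the number of variables.

  Light : Matrix → List I → List V → ℕ → V → Set
  Light M R X k v = v ∈ X × occurrences M R v ≤ N k × (∀ b → degree M R b v ≤ k)

  larger-value : (f : Bool → ℕ) → ∃[ b ] f (not b) ≤ f b
  larger-value f with ≤-total (f true) (f false)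
  ... | inj₁ t≤f = false , t≤f
  ... | inj₂ f≤t = true , f≤t

  sum≤2* : ∀ (f : Bool → ℕ) b → f (not b) ≤ f b → f true + f false ≤ 2 * f b
  sum≤2* f true  le = ≤-trans (+-monoʳ-≤ (f true) le)
    (≤-reflexive (cong (_+_ (f true)) (sym (+-identityʳ (f true)))))
  sum≤2* f false le = ≤-trans (+-monoˡ-≤ (f false) le)
    (≤-reflexive (cong (_+_ (f false)) (sym (+-identityʳ (f false)))))

  -- The first component is positivity of the deficiency; in the second, deficiency at most `k` is
  -- written additively to avoid subtraction. They are proved together because the literal degree
  -- bound rests on positivity after splitting. Quantifying over `k` lets the induction hypothesis
  -- be used at a smaller deficiency bound.
  deficiency-and-degree : ∀ n {M R X} → length X ≡ n → Unique R → Unique X → MinUnsat M R X →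
    n < length R × (∀ k → 0 < n → length R ≤ n + k → ∃ (Light M R X k))
  deficiency-and-degree zero {R = R} eq _ _ mu with i , i∈R , _ ← falsified mu (λ _ → false) =
    ∈-length i∈R , λ _ ()
  deficiency-and-degree (suc n) {M₀} {R} {X@(x ∷ X₀)} eq uR uX mu₀
    with M , M₀⊑M , mu , saturated ← saturate _ ≤-refl mu₀ = n<c , light
    where
    v = argmin (occurrences M R) x X₀

    v∈X : v ∈ X
    v∈X = argmin-all (occurrences M R) {P = _∈ X} (here refl) (All.tabulate there)

    minimal : ∀ {w} → w ∈ X → occurrences M R v ≤ occurrences M R w
    minimal (here refl) = f[argmin]≤f[⊤] {f = occurrences M R} x X₀
    minimal (there w∈)  = All.lookup (f[argmin]≤f[xs] {f = occurrences M R} x X₀) w∈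

    deg : Bool → ℕ
    deg b = degree M R b v

    deg>0 : ∀ b → 0 < deg b
    deg>0 b with i , i∈R , e ← both-polarities mu v∈X b =
      filter-some (λ i → M i v ≟ᴹ just b) (lose i∈R e)

    rows : ∀ b → length R ≡ deg b + length (keep M R v b)
    rows b = length-filter-∁ (λ i → M i v ≟ᴹ just b) R

    n-drop : length (drop X v) ≡ n
    n-drop = suc-injective (trans (length-remove _≟_ uX v∈X) eq)

    ih = λ b → deficiency-and-degree n n-drop (filter⁺ (λ i → ¬? (M i v ≟ᴹ just b)) uR)
                 (filter⁺ (λ w → ¬? (w ≟ v)) uX)
                 (split mu saturated v∈X minimal b)

    -- By positivity after splitting, more than `n` rows are kept; the `deg b` removed rows come on
    -- top.
    deg+n<c : ∀ b → deg b + suc n ≤ length R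
    deg+n<c b = ≤-trans (+-monoʳ-≤ (deg b) (proj₁ (ih b))) (≤-reflexive (sym (rows b)))

    n<c : suc n < length R
    n<c = ≤-trans (+-monoˡ-≤ (suc n) (deg>0 true)) (deg+n<c true)

    light : ∀ k → 0 < suc n → length R ≤ suc n + k → ∃ (Light M₀ R X k)
    -- The bounds are shown for the saturated `M` and pass to `M₀`, whose degrees are no larger.
    light k _ c≤ = v , v∈X , ≤-trans (occurrences-mono {M₀} R M₀⊑M v) few
                     , λ b → ≤-trans (degree-mono {M₀} R M₀⊑M b v) (deg≤k b)
      where
      deg≤k : ∀ b → deg b ≤ k
      deg≤k b = +-cancelˡ-≤ (suc n) _ _ (≤-trans (≤-reflexive (+-comm (suc n) (deg b)))
                  (≤-trans (deg+n<c b) c≤))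

      ≤2deg : ∀ b → deg (not b) ≤ deg b → occurrences M R v ≤ 2 * deg b
      ≤2deg b le = ≤-trans (≤-reflexive (occurrences≡ M R v)) (sum≤2* deg b le)

      small : ∀ b → deg (not b) ≤ deg b → deg b ≤ 1 → occurrences M R v ≤ N k
      small b le ≤1 = ≤-trans (≤2deg b le) (≤-trans (*-monoʳ-≤ 2 ≤1)
                        (2≤N k (≤-trans (deg>0 b) (deg≤k b))))

      large : ∀ b → deg (not b) ≤ deg b → 2 ≤ deg b → 0 < n → occurrences M R v ≤ N k
      large b le 2≤ 0<n = let w , w∈ , few , _ = proj₂ (ih b) (k ∸ deg b + 1) 0<n c′≤ in
        ≤-trans (⊓-glb (≤2deg b le)
                  (≤-trans (minimal (proj₁ (∈-filter⁻ (λ w → ¬? (w ≟ v)) {xs = X} w∈)))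
                  (≤-trans (occurrences-keep M R v b w) (+-monoˡ-≤ (deg b) few))))
                (N-lower k (deg b) 2≤ (deg≤k b))
        where
        open ≤-Reasoning
        -- Splitting loses `deg b` rows but only the one column `v`, whence the `+ 1`.
        c′≤ : length (keep M R v b) ≤ n + (k ∸ deg b + 1)
        c′≤ = +-cancelˡ-≤ (deg b) _ _ (begin
          deg b + length (keep M R v b)   ≡⟨ rows b ⟨
          length R                        ≤⟨ c≤ ⟩
          suc n + k                       ≡⟨ cong (_+_ (suc n)) (m+[n∸m]≡n (deg≤k b)) ⟨
          suc n + (deg b + (k ∸ deg b))   ≡⟨ regroup n (deg b) (k ∸ deg b) ⟩
          deg b + (n + (k ∸ deg b + 1))   ∎)
          where
          regroup : ∀ n d e → suc n + (d + e) ≡ d + (n + (e + 1))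
          regroup = solve-∀

      few : occurrences M R v ≤ N k
      few with larger-value deg
      ... | b , le with ≤-<-connex (deg b) 1
      ...   | inj₁ ≤1 = small b le ≤1
      ...   | inj₂ 2≤ with ≤-<-connex n 0
      ...     | inj₂ 0<n = large b le 2≤ 0<n
      -- With `v` the only variable, setting it to `not b` leaves no column and hence at most one
      -- row. All rows containing `v` with sign `b` are kept, so `deg b ≤ 1`.
      ...     | inj₁ n≤0 = small b le (≤-trans (length-filter-mono-≤
                    (λ i → M i v ≟ᴹ just b) (λ i → ¬? (M i v ≟ᴹ just (not b))) R λ _ eq eq′ →
                    not-¬ refl (just-injective (trans (sym eq) eq′)))
                  (length-rows≤1 (trans n-drop (n≤0⇒n≡0 n≤0))
                    (filter⁺ (λ i → ¬? (M i v ≟ᴹ just (not b))) uR)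
                    (split mu saturated v∈X minimal (not b))))

-- From clause-sets to matrices.

module _ (S : Setoid 0ℓ 0ℓ) where
  open Setoid S using (Carrier) renaming (_≈_ to _≈ₛ_; sym to ≈-sym)

  -- Guarantees that deleting `clause i` from `F` up to `_≈_` deletes no other row, so that
  -- minimality of `F` yields critical assignments.
  lookup-injective : ∀ {xs : List Carrier} → Setoid-Unique S xs →
                     ∀ i j → lookup xs i ≈ₛ lookup xs j → i ≡ j
  lookup-injective {_ ∷ _} _ Fin.zero Fin.zero _ = refl
  lookup-injective {_ ∷ _} (x∉ ∷ _) Fin.zero (Fin.suc j) e =
    contradiction e (All.lookup x∉ (∈-lookup j))
  lookup-injective {_ ∷ _} (x∉ ∷ _) (Fin.suc i) Fin.zero e =
    contradiction (≈-sym e) (All.lookup x∉ (∈-lookup i))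
  lookup-injective {_ ∷ _} (_ ∷ u) (Fin.suc i) (Fin.suc j) e = cong Fin.suc (lookup-injective u i j e)

length-filter-map : ∀ {A B : Set} (f : A → B) {P : Pred A 0ℓ} {Q : Pred B 0ℓ}
                    (P? : Decidable P) (Q? : Decidable Q) →
                    (∀ {x} → P x → Q (f x)) → (∀ {x} → Q (f x) → P x) → ∀ xs →
                    length (filter P? xs) ≡ length (filter Q? (map f xs))
length-filter-map f P? Q? P⇒Q Q⇒P [] = refl
length-filter-map f P? Q? P⇒Q Q⇒P (x ∷ xs)
  with length-filter-map f P? Q? P⇒Q Q⇒P xs | P? x | Q? (f x)
... | ih | yes p | yes q = cong suc ih
... | ih | yes p | no ¬q = contradiction (P⇒Q p) ¬q
... | ih | no ¬p | yes q = contradiction (Q⇒P q) ¬p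
... | ih | no _  | no _  = ih

⊖≤⇒≤+ : ∀ m n {k} → m ⊖ n ≤ᶻ + k → m ≤ n + k
⊖≤⇒≤+ m n le with ≤-total n m
... | inj₂ m≤n = ≤-trans m≤n (m≤m+n n _)
... | inj₁ n≤m = ≤-trans (≤-reflexive (sym (m+[n∸m]≡n n≤m)))
  (+-monoʳ-≤ n (ℤ.drop‿+≤+ (subst (_≤ᶻ _) (ℤ.⊖-≥ n≤m) le)))

module Encoding {V : Set} (_≟_ : DecidableEquality V) where
  open CNF _≟_

  literal : Bool → V → Literal
  literal true  = pos
  literal false = neg

  entry : Clause → V → Maybe Bool
  entry C v = if does (pos v ∈ˡ? literals C) then just true
              else if does (neg v ∈ˡ? literals C) then just false else nothing

  entry-sound : ∀ C v {b} → entry C v ≡ just b → literal b v ∈ literals C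
  entry-sound C v eq with pos v ∈ˡ? literals C
  entry-sound C v refl | yes p = p
  ... | no _ with neg v ∈ˡ? literals C
  entry-sound C v refl | no _ | yes p = p

  entry-complete : ∀ C v b → literal b v ∈ literals C → entry C v ≡ just b
  entry-complete C v true p rewrite dec-true (pos v ∈ˡ? literals C) p = refl
  entry-complete C v false p
    -- `entry` tests `pos v` first; clash-freeness keeps this test from hiding `neg v`.
    rewrite dec-false (pos v ∈ˡ? literals C) (λ q → clash-free C (q , ∈-map⁺ ‾_ p))
          | dec-true (neg v ∈ˡ? literals C) p = refl

  ∈⇒∈ᶜ : ∀ {C Cs} → C ∈ Cs → C ∈ᶜ Cs
  ∈⇒∈ᶜ {C} = Any.map λ { refl → Setoid.refl clauseSetoid {C} }

  module _ (F : ClauseSet) where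

    clause : Fin (c F) → Clause
    clause = lookup (clauses F)

    open Matrices (Fin._≟_ {c F}) _≟_ public

    matrix : Matrix
    matrix i = entry (clause i)

    rows : List (Fin (c F))
    rows = allFin (c F)

    map-clause-rows : map clause rows ≡ clauses F
    map-clause-rows = trans (map-tabulate id clause) (tabulate-lookup (clauses F))

    degree≡ld : ∀ b v → degree matrix rows b v ≡ ld F (literal b v)
    degree≡ld b v = trans
      (length-filter-map clause (λ i → matrix i v ≟ᴹ just b) (λ C → literal b v ∈ˡ? literals C)
        (λ {i} → entry-sound (clause i) v) (λ {i} → entry-complete (clause i) v b) rows)
      (cong (λ Cs → length (filter (λ C → literal b v ∈ˡ? literals C) Cs)) map-clause-rows)

    occurrences≡vdeg : ∀ v → occurrences matrix rows v ≡ vdeg F v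
    occurrences≡vdeg v =
      trans (occurrences≡ matrix rows v) (cong₂ _+_ (degree≡ld true v) (degree≡ld false v))

    var∈vars : ∀ {C x} → C ∈ clauses F → x ∈ literals C → var x ∈ vars F
    var∈vars C∈F x∈C = ∈-deduplicate⁺ _≟_
      (∈-concatMap⁺ (map var ∘ literals) (lose C∈F (∈-map⁺ var x∈C)))

    ∈ᶜ⇒clause : ∀ {C} → C ∈ᶜ clauses F → ∃[ i ] C ≈ clause i
    ∈ᶜ⇒clause C∈F = Any.index C∈F , lookup-index C∈F

    clause∈ᶜ : ∀ i → clause i ∈ᶜ clauses F
    clause∈ᶜ i = ∈⇒∈ᶜ (∈-lookup {xs = clauses F} i)

    satisfying : ∀ i a x → x ∈ literals (clause i) → literal (a (var x)) (var x) ≡ x →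
                 Satisfies matrix (vars F) a i
    satisfying i a x x∈ eq = lose (var∈vars (∈-lookup {xs = clauses F} i) x∈)
      (entry-complete (clause i) (var x) _ (subst (_∈ literals (clause i)) (sym eq) x∈))

    -- Assignments of matrices are total, so values outside `vars F` are discarded to make the
    -- support finite.
    restrict : Assignment → PartialAssignment
    restrict a = record
      { value   = λ v → if does (v ∈ᵛ? vars F) then just (a v) else nothing
      ; support = vars F
      ; finite  = finite′
      }
      where
      finite′ : ∀ {v b} → (if does (v ∈ᵛ? vars F) then just (a v) else nothing) ≡ just b →
                v ∈ vars F
      finite′ {v} eq with v ∈ᵛ? vars F
      finite′ {v} eq | yes v∈ = v∈

    evaluate-restrict : ∀ a {v} → v ∈ vars F → evaluate (restrict a) (literal (a v) v) ≡ just true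
    evaluate-restrict a {v} v∈ with a v in eq
    ... | true  rewrite dec-true (v ∈ᵛ? vars F) v∈ = cong just eq
    ... | false rewrite dec-true (v ∈ᵛ? vars F) v∈ = cong (just ∘ not) eq

    -- The default `false` is harmless: a literal that evaluates to true has a variable with a
    -- defined value.
    total : PartialAssignment → Assignment
    total φ v = fromMaybe false (value φ v)

    literal-total : ∀ φ x → evaluate φ x ≡ just true → literal (total φ (var x)) (var x) ≡ x
    literal-total φ (pos v) eq with value φ v
    literal-total φ (pos v) refl | just true = refl
    literal-total φ (neg v) eq with value φ v
    literal-total φ (neg v) eq | just false = refl

    Sat⇒Satisfiable : Sat matrix rows (vars F) → Satisfiable F
    Sat⇒Satisfiable (a , sat) = restrict a , λ C C∈F →
      let i , _ , i⊆C = ∈ᶜ⇒clause {C} C∈F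
          v , v∈X , e = find (All.lookup sat (∈-allFin i))
      in literal (a v) v , i⊆C (entry-sound (clause i) v e) , evaluate-restrict a v∈X

    minUnsat : MinimallyUnsatisfiable F → MinUnsat matrix rows (vars F)
    minUnsat (unsat , minimal) = record
      { unsat    = unsat ∘ Sat⇒Satisfiable
      ; critical = λ {i} _ → critical i
      ; occurs   = λ v∈X →
          let C , C∈F , v∈C  = find (∈-concatMap⁻ (map var ∘ literals) (∈-deduplicate⁻ _≟_ _ v∈X))
              x , x∈C , v≡x  = ∈-map⁻ var v∈C
              i , C⊆i , _    = ∈ᶜ⇒clause {C} (∈⇒∈ᶜ C∈F)
          in i , ∈-allFin i , λ none → entry-nonempty (clause i) x (C⊆i x∈C)
               (subst (λ w → entry (clause i) w ≡ nothing) v≡x none)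
      }
      where
      entry-nonempty : ∀ C x → x ∈ literals C → entry C (var x) ≢ nothing
      entry-nonempty C (pos v) x∈ none =
        contradiction (trans (sym none) (entry-complete C v true x∈)) λ ()
      entry-nonempty C (neg v) x∈ none =
        contradiction (trans (sym none) (entry-complete C v false x∈)) λ ()

      critical : ∀ i → ∃[ a ] (∀ {j} → j ∈ rows → j ≢ i → Satisfies matrix (vars F) a j)
      critical i with φ , sat ← minimal (clause i) (clause∈ᶜ i) = total φ , λ {j} _ j≢i →
        let x , x∈ , e = sat (clause j) (∈⇒∈ᶜ
              (∈-filter⁺ (λ D → ¬? (D ≈? clause i)) (∈-lookup {xs = clauses F} j)
                (λ e → j≢i (lookup-injective clauseSetoid (distinct F) j i e))))
        in satisfying j (total φ) x x∈ (literal-total φ x e)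

    -- Without variables every clause is empty, and unsatisfiability provides at least one clause,
    -- so `F` would consist of the empty clause.
    0<n : MinUnsat matrix rows (vars F) → ¬ (F ≋ ⟨ ⊥ᶜ ⟩) → 0 < n F
    0<n mu ≢⊥ = n≢0⇒n>0 λ n≡0 → ≢⊥ ((λ {C} → F⊆⊥ n≡0 {C}) , (λ {C} → ⊥⊆F n≡0 {C}))
      where
      no-vars : n F ≡ 0 → ∀ {v} → ¬ v ∈ vars F
      no-vars n≡0 v∈ = <-irrefl (sym n≡0) (∈-length v∈)

      ≈⊥ : n F ≡ 0 → ∀ i → clause i ≈ ⊥ᶜ
      ≈⊥ n≡0 i = (λ x∈ → contradiction (var∈vars (∈-lookup {xs = clauses F} i) x∈) (no-vars n≡0))
               , λ ()

      F⊆⊥ : n F ≡ 0 → ∀ {C} → C ∈ᶜ clauses F → C ∈ᶜ (⊥ᶜ ∷ [])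
      F⊆⊥ n≡0 {C} C∈F =
        let i , C≈i = ∈ᶜ⇒clause {C} C∈F
        in here (Setoid.trans clauseSetoid {C} {clause i} {⊥ᶜ} C≈i (≈⊥ n≡0 i))

      ⊥⊆F : n F ≡ 0 → ∀ {C} → C ∈ᶜ (⊥ᶜ ∷ []) → C ∈ᶜ clauses F
      ⊥⊆F n≡0 {C} (here C≈⊥) =
        let i , _ = MinUnsat.falsified mu (λ _ → false)
        in Setoid-∈-resp-≈ clauseSetoid {x = clause i} {C}
             (Setoid.trans clauseSetoid {clause i} {⊥ᶜ} {C} (≈⊥ n≡0 i) (swap C≈⊥)) (clause∈ᶜ i)

  -- The minimal variable degree and the conclusion.

  minvdeg≤vdeg : ∀ F {v m} → v ∈ vars F → vdeg F v ≤ m → minvdeg F ≤⁺ [ m ]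
  minvdeg≤vdeg F v∈ le with vars F
  minvdeg≤vdeg F (here refl) le | v ∷ vs =
    [ min≤v⁺ _ (map (vdeg F) vs) (inj₁ le) ]⁺
  minvdeg≤vdeg F (there v∈) le  | v ∷ vs =
    [ min≤v⁺ _ (map (vdeg F) vs) (inj₂ (lose (∈-map⁺ (vdeg F) v∈) le)) ]⁺

theorem8p3 : {V : Set} (_≟_ : DecidableEquality V) → let open CNF _≟_ in
    (k : ℕ) .{{_ : NonZero k}} (F : ClauseSet) →
    MinimallyUnsatisfiable F → δ F ≤ᶻ + k → ¬ (F ≋ ⟨ ⊥ᶜ ⟩) →
    (minvdeg F ≤⁺ [ N k ]) ×
    (∃[ v ] (v ∈ᵛ vars F × vdeg F v ≤ N k × ld F (pos v) ≤ k × ld F (‾ pos v) ≤ k))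
theorem8p3 _≟_ k F mu δ≤k F≢⊥ =
  let v , v∈F , few , deg≤k = proj₂ bounds k (0<n F (minUnsat F mu) F≢⊥) c≤n+k
      vdeg≤N = subst (_≤ N k) (occurrences≡vdeg F v) few
  in minvdeg≤vdeg F v∈F vdeg≤N
   , v , v∈F , vdeg≤N , subst (_≤ k) (degree≡ld F true v) (deg≤k true)
   , subst (_≤ k) (degree≡ld F false v) (deg≤k false)
  where
  open CNF _≟_
  open Encoding _≟_
  bounds = deficiency-and-degree F (n F) refl (allFin⁺ (c F)) (deduplicate-! _≟_ _) (minUnsat F mu)
  c≤n+k : length (rows F) ≤ n F + k
  c≤n+k = ≤-trans (≤-reflexive (length-tabulate id)) (⊖≤⇒≤+ (c F) (n F) δ≤k)
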